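{- Over the dependent type theory $\mathcal{H}$, the following are equivalent: (a) there is a type $\mathsf{2}$ satisfying the formation, introduction, elimination, and propositional computation rules for $\mathsf{2}$; (b) there exists a homotopy-initial $\mathsf{2}$-algebra. (In direction (b)$\Rightarrow$(a), the type underlying the homotopy-initial $\mathsf{2}$-algebra, with its two elements, satisfies the rules; in direction (a)$\Rightarrow$(b), $(\mathsf{2},0,1)$ is homotopy-initial.)
   Context: $\mathcal{H}$ is the intensional Martin-Löf dependent type theory with judgements $A:\mathsf{type}$, $A=B:\mathsf{type}$, $a:A$, $a=b:A$ (definitional equality), having: intensional identity types $\mathsf{Id}_A(a,b)$ with $\mathsf{refl}$ and the usual elimination $\mathsf{idrec}$ and definitional computation rule; $\Sigma$-types (with pairing and projections $\pi_1,\pi_2$); $\Pi$-types (with $\lambda$ and application, $A\to B$ the non-dependent case, $A\times B$ the non-dependent $\Sigma$); the propositional $\eta$-rule for $\Pi$-types (for every $f:(\Pi x:A)B(x)$ the type $\mathsf{Id}(f,\lambda x.f(x))$ is inhabited); and the function extensionality axiom: for all $f,g:A\to B$ the type $(\Pi x:A)\mathsf{Id}_B(f x,g x)\to \mathsf{Id}_{A\to B}(f,g)$ is inhabited. No definitional $\eta$-rules, no identity reflection, no K/UIP. Rules for $\mathsf{2}$: formation $\mathsf{2}:\mathsf{type}$; introduction $0:\mathsf{2}$, $1:\mathsf{2}$; elimination: given $x:\mathsf{2}\vdash C(x):\mathsf{type}$, $c_0:C(0)$, $c_1:C(1)$, one has $x:\mathsf{2}\vdash \mathsf{2rec}(x,c_0,c_1):C(x)$;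 propositional computation: under the same premisses there are terms $\mathsf{2comp}_0(c_0,c_1):\mathsf{Id}_{C(0)}(\mathsf{2rec}(0,c_0,c_1),c_0)$ and $\mathsf{2comp}_1(c_0,c_1):\mathsf{Id}_{C(1)}(\mathsf{2rec}(1,c_0,c_1),c_1)$. A $\mathsf{2}$-algebra is a triple $(C,c_0,c_1)$ with $C$ a type and $c_0,c_1:C$. The type of weak homomorphisms is $\mathsf{2}\text{ - }\mathsf{Alg}[(C,c_0,c_1),(D,d_0,d_1)] := (\Sigma f:C\to D)\,\mathsf{Id}_D(f(c_0),d_0)\times \mathsf{Id}_D(f(c_1),d_1)$. A type $X$ is contractible if $\mathsf{iscontr}(X):=(\Sigma x:X)(\Pi y:X)\mathsf{Id}_X(x,y)$ is inhabited. A $\mathsf{2}$-algebra $(C,c_0,c_1)$ is homotopy-initial if for every $\mathsf{2}$-algebra $(D,d_0,d_1)$ the type $\mathsf{2}\text{ - }\mathsf{Alg}[(C,c_0,c_1),(D,d_0,d_1)]$ is contractible. -}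

{-# OPTIONS --without-K #-}
module Defs where

open import Level using (Level; _⊔_; suc)
open import Data.Product using (Σ; _×_; _,_)
open import Relation.Binary.PropositionalEquality using (_≡_)

-- Identity types: Agda's _≡_ (intensional, used --without-K, so no K/UIP).
-- Propositional (even definitional) η for Π holds in Agda.

FunExt : (ℓ : Level) → Set (suc ℓ)
FunExt ℓ = {A B : Set ℓ} (f g : A → B) → ((x : A) → f x ≡ g x) → f ≡ g

iscontr : {ℓ : Level} → Set ℓ → Set ℓ
iscontr X = Σ X (λ x → (y : X) → x ≡ y)

record 2-Algebra (ℓ : Level) : Set (suc ℓ) where
  constructor alg
  field
    Carrier : Set ℓ
    pt₀ : Carrier
    pt₁ : Carrier

open 2-Algebra public

2-Alg[_,_] : {ℓ : Level} → 2-Algebra ℓ → 2-Algebra ℓ → Set ℓ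
2-Alg[ alg C c₀ c₁ , alg D d₀ d₁ ] =
  Σ (C → D) (λ f → (f c₀ ≡ d₀) × (f c₁ ≡ d₁))

IsHInitial : {ℓ : Level} → 2-Algebra ℓ → Set (suc ℓ)
IsHInitial {ℓ} A = (D : 2-Algebra ℓ) → iscontr 2-Alg[ A , D ]

-- The elimination rule with propositional computation rules for a type B
-- with points b₀ b₁ (formation and introduction are given by B, b₀, b₁):
-- for every family C over B and c₀ : C b₀, c₁ : C b₁ there is
-- 2rec : (x : B) → C x with 2comp₀ : 2rec b₀ ≡ c₀ and 2comp₁ : 2rec b₁ ≡ c₁.
Has2Rules : {ℓ : Level} → 2-Algebra ℓ → Set (suc ℓ)
Has2Rules {ℓ} (alg B b₀ b₁) =
  (C : B → Set ℓ) (c₀ : C b₀) (c₁ : C b₁) →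
  Σ ((x : B) → C x) (λ rec → (rec b₀ ≡ c₀) × (rec b₁ ≡ c₁))

{-# OPTIONS --without-K #-}
-- (a) ⇒ (b): with function extensionality the rules make evaluation at the two
-- points, (B → D) → D × D, an equivalence, and the homomorphisms into
-- (D , d₀ , d₁) form its fibre over (d₀ , d₁), which is contractible.
-- (b) ⇒ (a): the homomorphism h from B into the total algebra Σ B C is a
-- section of proj₁, since proj₁ ∘ h and the identity are both endomorphisms of
-- the h-initial B; transporting the second component of h along this gives the
-- eliminator, and the computation rules come from the coherence between the
-- path proj₁ ∘ h ≡ id and the homomorphism proofs.
module Submission where

open import Defs
open import Level using (Level)
open import Function.Base using (id)
open import Function.Bundles using (_⇔_; _↔_; mk⇔; mk↔ₛ′; Inverse)
open import Function.Properties.Inverse using (↔-refl; ↔-sym)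
open import Function.Properties.Inverse.HalfAdjointEquivalence using (_≃_; ↔⇒≃)
open import Data.Product using (Σ; _×_; _,_; proj₁; proj₂)
open import Data.Product.Properties using (,-injective; ×-≡,≡↔≡)
open import Data.Product.Function.Dependent.Propositional using (Σ-↔)
open import Relation.Binary.PropositionalEquality

module _ {ℓ : Level} where

  iscontr-≡ : {X : Set ℓ} → iscontr X → (x y : X) → x ≡ y
  iscontr-≡ (c , contract) x y = trans (sym (contract x)) (contract y)

  iscontr-↔ : {X Y : Set ℓ} → X ↔ Y → iscontr X → iscontr Y
  iscontr-↔ X↔Y (c , contract) =
    to c , λ y → trans (cong to (contract (from y))) (strictlyInverseˡ y)
    where open Inverse X↔Y

  fiber : {A B : Set ℓ} → (A → B) → B → Set ℓ
  fiber {A} f y = Σ A (λ x → f x ≡ y)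

  ≃-fiber-iscontr : {A B : Set ℓ} (e : A ≃ B) (y : B) → iscontr (fiber (_≃_.to e) y)
  ≃-fiber-iscontr {A} {B} e y = (from y , right-inverse-of y) , λ (x , p) → contract x p
    where
    open _≃_ e
    cong-to-fiber : {a x : A} (q : a ≡ x) →
                    _≡_ {A = fiber to (to x)} (a , cong to q) (x , refl)
    cong-to-fiber refl = refl
    contract : (x : A) {z : B} (p : to x ≡ z) → (from z , right-inverse-of z) ≡ (x , p)
    -- The half-adjoint coherence left-right is what makes the second components agree.
    contract x refl =
      subst (λ r → (from (to x) , r) ≡ (x , refl)) (left-right x)
            (cong-to-fiber (left-inverse-of x))

  subst-cong-proj₁ : {A : Set ℓ} (C : A → Set ℓ) {u v : Σ A C} (p : u ≡ v) →
                     subst C (cong proj₁ p) (proj₂ u) ≡ proj₂ v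
  subst-cong-proj₁ C refl = refl

  evaluate : (B : 2-Algebra ℓ) {D : Set ℓ} → (Carrier B → D) → D × D
  evaluate B f = f (pt₀ B) , f (pt₁ B)

  Has2Rules⇒≗ : {B : 2-Algebra ℓ} → Has2Rules B → {D : Set ℓ} {f g : Carrier B → D} →
                evaluate B f ≡ evaluate B g → ∀ x → f x ≡ g x
  Has2Rules⇒≗ rules {f = f} {g} eq =
    let (eq₀ , eq₁) = ,-injective eq in proj₁ (rules (λ x → f x ≡ g x) eq₀ eq₁)

  Has2Rules⇒evaluate-↔ : FunExt ℓ → (B : 2-Algebra ℓ) → Has2Rules B →
                         {D : Set ℓ} → (Carrier B → D) ↔ (D × D)
  Has2Rules⇒evaluate-↔ funext B rules {D} =
    mk↔ₛ′ (evaluate B) recursor evaluate-recursor recursor-evaluate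
    where
    recursor : D × D → Carrier B → D
    recursor (d₀ , d₁) = proj₁ (rules (λ _ → D) d₀ d₁)
    evaluate-recursor : ∀ d → evaluate B (recursor d) ≡ d
    evaluate-recursor (d₀ , d₁) =
      let (_ , comp₀ , comp₁) = rules (λ _ → D) d₀ d₁ in cong₂ _,_ comp₀ comp₁
    recursor-evaluate : ∀ f → recursor (evaluate B f) ≡ f
    recursor-evaluate f = funext _ _ (Has2Rules⇒≗ rules (evaluate-recursor (evaluate B f)))

  2-Alg↔fiber-evaluate : (B D : 2-Algebra ℓ) →
                         2-Alg[ B , D ] ↔ fiber (evaluate B) (pt₀ D , pt₁ D)
  2-Alg↔fiber-evaluate B D = Σ-↔ ↔-refl ×-≡,≡↔≡

  Has2Rules⇒IsHInitial : FunExt ℓ → (B : 2-Algebra ℓ) → Has2Rules B → IsHInitial B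
  Has2Rules⇒IsHInitial funext B rules D =
    iscontr-↔ (↔-sym (2-Alg↔fiber-evaluate B D))
              (≃-fiber-iscontr (↔⇒≃ (Has2Rules⇒evaluate-↔ funext B rules)) _)

  idHom : (A : 2-Algebra ℓ) → 2-Alg[ A , A ]
  idHom A = id , refl , refl

  idHom-≡⇒coherence : {A : 2-Algebra ℓ} {m : 2-Alg[ A , A ]} (e : idHom A ≡ m) →
                      let x≡m[x] = cong-app (cong proj₁ e) in
                      (proj₁ (proj₂ m) ≡ sym (x≡m[x] (pt₀ A))) ×
                      (proj₂ (proj₂ m) ≡ sym (x≡m[x] (pt₁ A)))
  idHom-≡⇒coherence refl = refl , refl

  IsHInitial⇒Has2Rules : (B : 2-Algebra ℓ) → IsHInitial B → Has2Rules B
  IsHInitial⇒Has2Rules A@(alg B b₀ b₁) initial C c₀ c₁ =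
    rec , computes h-pt₀ (proj₁ coherence) , computes h-pt₁ (proj₂ coherence)
    where
    hom : 2-Alg[ A , alg (Σ B C) (b₀ , c₀) (b₁ , c₁) ]
    hom = proj₁ (initial (alg (Σ B C) (b₀ , c₀) (b₁ , c₁)))
    h : B → Σ B C
    h = proj₁ hom
    h-pt₀ : h b₀ ≡ (b₀ , c₀)
    h-pt₀ = proj₁ (proj₂ hom)
    h-pt₁ : h b₁ ≡ (b₁ , c₁)
    h-pt₁ = proj₂ (proj₂ hom)
    proj₁∘h : 2-Alg[ A , A ]
    proj₁∘h = (λ x → proj₁ (h x)) , cong proj₁ h-pt₀ , cong proj₁ h-pt₁
    idHom≡proj₁∘h : idHom A ≡ proj₁∘h
    idHom≡proj₁∘h = iscontr-≡ (initial A) _ _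
    x≡proj₁[h[x]] : ∀ x → x ≡ proj₁ (h x)
    x≡proj₁[h[x]] = cong-app (cong proj₁ idHom≡proj₁∘h)
    coherence : (cong proj₁ h-pt₀ ≡ sym (x≡proj₁[h[x]] b₀)) ×
                (cong proj₁ h-pt₁ ≡ sym (x≡proj₁[h[x]] b₁))
    coherence = idHom-≡⇒coherence idHom≡proj₁∘h
    rec : (x : B) → C x
    rec x = subst C (sym (x≡proj₁[h[x]] x)) (proj₂ (h x))
    computes : {b : B} {c : C b} (p : h b ≡ (b , c)) →
               cong proj₁ p ≡ sym (x≡proj₁[h[x]] b) → rec b ≡ c
    computes {b} {c} p cong-proj₁-p≡ = begin
      subst C (sym (x≡proj₁[h[x]] b)) (proj₂ (h b))
        ≡⟨ cong (λ q → subst C q (proj₂ (h b))) (sym cong-proj₁-p≡) ⟩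
      subst C (cong proj₁ p) (proj₂ (h b))
        ≡⟨ subst-cong-proj₁ C p ⟩
      c ∎
      where open ≡-Reasoning

proposition3p2 : {ℓ : Level} → FunExt ℓ → (B : 2-Algebra ℓ) →
    Has2Rules B ⇔ IsHInitial B
proposition3p2 funext B = mk⇔ (Has2Rules⇒IsHInitial funext B) (IsHInitial⇒Has2Rules B)
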